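{- Let $M\ge1$ and let $t$ be an integer with $t>2\log_2M$. Let $U,X,Y\le\mathbb F_2^n$ be subspaces whose sum $U\oplus X\oplus Y$ is an internal direct sum, with $\dim X=\dim Y=t$, and put $$H_0:=U\oplus X,\qquad H_1:=U\oplus Y,\qquad B:=U.$$ Consider any possibly randomized algorithm which receives only membership and exact uniform-sampling access to the common observation $B=U$, and which outputs either a subspace of $\mathbb F_2^n$ or $\mathsf{FAIL}$. For $i\in\{0,1\}$, let $\mathcal S_i$ be the event that its output $\widehat V$ is a subspace satisfying $$|\widehat V|\le|H_i|,\qquad\mathcal N_{\widehat V}(H_i)\le M.$$ Then $$\min\{\Pr[\mathcal S_0],\Pr[\mathcal S_1]\}\le\frac12 .$$
   Context: For a subspace $V\le\mathbb F_2^n$ and a set $S$, $\mathcal N_V(S)=\min\{|T|:S\subseteq T+V\}$ is the minimum number of $V$-cosets needed to cover $S$, where $T+V=\{t+v:t\in T,v\in V\}$. Access to $B$ means a deterministic membership oracle $x\mapsto\mathbf 1_B(x)$ and an oracle returning independent exactly uniform samples from $B$; the hidden set ($H_0$ or $H_1$) is not accessible, so the output distribution of the algorithm depends only on $B$ and is the same for both hidden instances. -}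

module Defs where

open import Data.Bool.Base using (Bool; true; false; T; _∧_; _∨_; _xor_; not; if_then_else_)
import Data.Bool.Properties as Bool
open import Data.Bool.ListAction using (all; any)
open import Data.Fin.Base using (Fin)
open import Data.Integer.Base using (+_)
open import Data.List.Base
  using (List; []; _∷_; [_]; _++_; allFin; cartesianProductWith; filterᵇ; foldr; length; map)
open import Data.List.Extrema.Nat using (min)
open import Data.Maybe.Base using (Maybe)
open import Data.Maybe.Relation.Unary.Any using (Any)
open import Data.Nat.Base as ℕ using (ℕ; zero; suc)
open import Data.Product.Base using (∃; _×_; _,_)
open import Data.Rational.Base as ℚ using (ℚ; 0ℚ; 1ℚ)
import Data.Rational.Properties as ℚ
open import Data.Vec.Base as Vec using (Vec; []; _∷_)
open import Data.Vec.Properties using (≡-dec)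
open import Function.Base using (_∘_; const)
open import Relation.Binary.Definitions using (DecidableEquality; tri<; tri≈; tri>)
open import Relation.Binary.PropositionalEquality using (_≡_; subst; sym)
open import Relation.Nullary.Decidable using (⌊_⌋)

------------------------------------------------------------------------
-- The vector space 𝔽₂ⁿ, with (Bool, xor, ∧) as the field 𝔽₂

𝔽₂^ : ℕ → Set
𝔽₂^ n = Vec Bool n

infixl 6 _+ᵛ_
infixl 7 _·ᵛ_
infix 4 _≟ᵛ_

0ᵛ : ∀ {n} → 𝔽₂^ n
0ᵛ = Vec.replicate _ false

_+ᵛ_ : ∀ {n} → 𝔽₂^ n → 𝔽₂^ n → 𝔽₂^ n
_+ᵛ_ = Vec.zipWith _xor_

_·ᵛ_ : ∀ {n} → Bool → 𝔽₂^ n → 𝔽₂^ n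
c ·ᵛ v = Vec.map (c ∧_) v

_≟ᵛ_ : ∀ {n} → DecidableEquality (𝔽₂^ n)
_≟ᵛ_ = ≡-dec Bool._≟_

-- Every vector, listed exactly once.
points : ∀ n → List (𝔽₂^ n)
points zero    = [ [] ]
points (suc n) = map (false ∷_) (points n) ++ map (true ∷_) (points n)

------------------------------------------------------------------------
-- Subsets of 𝔽₂ⁿ, given by their indicator functions

Subset : ℕ → Set
Subset n = 𝔽₂^ n → Bool

infix 4 _∈_ _⊆ᵇ_

_∈_ : ∀ {n} → 𝔽₂^ n → Subset n → Set
x ∈ S = T (S x)

elements : ∀ {n} → Subset n → List (𝔽₂^ n)
elements S = filterᵇ S (points _)

∣_∣ : ∀ {n} → Subset n → ℕ
∣ S ∣ = length (elements S)

_⊆ᵇ_ : ∀ {n} → Subset n → Subset n → Bool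
A ⊆ᵇ B = all (λ x → not (A x) ∨ B x) (points _)

-- The sumset { a + b : a ∈ A, b ∈ B }.
infixl 6 _+ˢ_

_+ˢ_ : ∀ {n} → Subset n → Subset n → Subset n
(A +ˢ B) x = any (λ a → any (λ b → A a ∧ B b ∧ ⌊ a +ᵛ b ≟ᵛ x ⌋) (points _)) (points _)

-- Every subset, listed exactly once up to pointwise equality of indicator
-- functions.
subsets : ∀ n → List (Subset n)
subsets zero    = const false ∷ const true ∷ []
subsets (suc n) = cartesianProductWith glue (subsets n) (subsets n)
  where
  glue : Subset n → Subset n → Subset (suc n)
  glue A B (b ∷ v) = if b then B v else A v

------------------------------------------------------------------------
-- Subspaces

record Subspace (n : ℕ) : Set where
  field
    carrier  : Subset n
    0∈       : 0ᵛ ∈ carrier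
    +-closed : ∀ {x y} → x ∈ carrier → y ∈ carrier → x +ᵛ y ∈ carrier
    ·-closed : ∀ c {x} → x ∈ carrier → c ·ᵛ x ∈ carrier

open Subspace public using (carrier)

linearCombination : ∀ {n t} → Vec Bool t → Vec (𝔽₂^ n) t → 𝔽₂^ n
linearCombination cs vs = Vec.foldr′ _+ᵛ_ 0ᵛ (Vec.zipWith _·ᵛ_ cs vs)

record Basis {n} (V : Subspace n) (t : ℕ) : Set where
  field
    vectors     : Vec (𝔽₂^ n) t
    inside      : ∀ i → Vec.lookup vectors i ∈ carrier V
    independent : ∀ cs → linearCombination cs vectors ≡ 0ᵛ → cs ≡ 0ᵛ
    spanning    : ∀ {x} → x ∈ carrier V → ∃ λ cs → linearCombination cs vectors ≡ x

infix 4 _HasDimension_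

_HasDimension_ : ∀ {n} → Subspace n → ℕ → Set
V HasDimension t = Basis V t

-- The sum U + X + Y is an internal direct sum: each of its elements has only
-- one decomposition.
IsDirectSum : ∀ {n} → Subspace n → Subspace n → Subspace n → Set
IsDirectSum U X Y =
  ∀ {u u′ x x′ y y′} →
  u ∈ carrier U → u′ ∈ carrier U →
  x ∈ carrier X → x′ ∈ carrier X →
  y ∈ carrier Y → y′ ∈ carrier Y →
  u +ᵛ x +ᵛ y ≡ u′ +ᵛ x′ +ᵛ y′ →
  u ≡ u′ × x ≡ x′ × y ≡ y′

-- min { |T| : S ⊆ T + V }.  The first argument of min, needed for the minimum
-- of a list to be total, is the size of T = 𝔽₂ⁿ, which always qualifies.
coveringNumber : ∀ {n} → Subspace n → Subset n → ℕ
coveringNumber {n} V S =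
  min ∣ const {B = 𝔽₂^ n} true ∣
      (map ∣_∣ (filterᵇ (λ A → S ⊆ᵇ A +ˢ carrier V) (subsets n)))

------------------------------------------------------------------------
-- Extended reals, as open lower Dedekind cuts of ℚ (the empty cut is -∞ and
-- the full cut is +∞)

record ℝ̄ : Set₁ where
  field
    below       : ℚ → Set     -- below q  means  q < x
    down-closed : ∀ {p q} → p ℚ.< q → below q → below p
    open-above  : ∀ {p} → below p → ∃ λ q → p ℚ.< q × below q

open ℝ̄

infix 4 _≤ℝ_

_≤ℝ_ : ℝ̄ → ℝ̄ → Set
x ≤ℝ y = ∀ {q} → below x q → below y q

fromℚ : ℚ → ℝ̄
fromℚ r .below q             = q ℚ.< r
fromℚ r .down-closed p<q q<r = ℚ.<-trans p<q q<r
fromℚ r .open-above p<r      = let m , p<m , m<r = ℚ.<-dense p<r in m , p<m , m<r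

fromℕ : ℕ → ℝ̄
fromℕ m = fromℚ (+ m ℚ./ 1)

sup : {I : Set} → (I → ℝ̄) → ℝ̄
sup x .below q                      = ∃ λ i → below (x i) q
sup x .down-closed p<q (i , q<xᵢ)   = i , down-closed (x i) p<q q<xᵢ
sup x .open-above (i , p<xᵢ)        = let q , p<q , q<xᵢ = open-above (x i) p<xᵢ in q , p<q , i , q<xᵢ

infixl 7 _⊓ℝ_

_⊓ℝ_ : ℝ̄ → ℝ̄ → ℝ̄
(x ⊓ℝ y) .below q                     = below x q × below y q
(x ⊓ℝ y) .down-closed p<q (q<x , q<y) = down-closed x p<q q<x , down-closed y p<q q<y
(x ⊓ℝ y) .open-above {p} (p<x , p<y) with open-above x p<x | open-above y p<y
... | q , p<q , q<x | r , p<r , r<y with ℚ.<-cmp q r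
... | tri< q<r _ _    = q , p<q , q<x , down-closed y q<r r<y
... | tri≈ _ q≡r _    = q , p<q , q<x , subst (below y) (sym q≡r) r<y
... | tri> _ _ r<q    = r , p<r , down-closed x r<q q<x , r<y

-- 2 log₂ x < t for x ≥ 1, in the form x² < 2ᵗ.
2log₂_<_ : ℝ̄ → ℕ → Set
2log₂ x < t = ∃ λ r → x ≤ℝ fromℚ r × r ℚ.* r ℚ.< + (2 ℕ.^ t) ℚ./ 1

------------------------------------------------------------------------
-- Randomized algorithms with membership and sampling access to a subset

-- The output of an algorithm; FAIL is nothing.
Output : ℕ → Set
Output n = Maybe (Subspace n)

data Action (n : ℕ) (State : Set) : Set where
  output : Output n → Action n State
  query  : 𝔽₂^ n → (Bool → State) → Action n State
  sample : (𝔽₂^ n → State) → Action n State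
  -- internal randomness, uniform on Fin (suc m)
  random : ∀ m → (Fin (suc m) → State) → Action n State

-- A possibly infinite-state machine, which need not halt within a bounded
-- number of steps; finite uniform draws then suffice to realize, almost surely,
-- every other source of discrete randomness.
record Algorithm (n : ℕ) : Set₁ where
  field
    State : Set
    start : State
    step  : State → Action n State

mean : List ℚ → ℚ
mean []       = 0ℚ
mean (q ∷ qs) = foldr ℚ._+_ 0ℚ (q ∷ qs) ℚ.* (+ 1 ℚ./ suc (length qs))

module _ {n} (𝒜 : Algorithm n) (B : Subset n) where
  open Algorithm 𝒜

  -- The probability that a run from state s with oracles for B halts within
  -- k steps with an output satisfying D.
  haltingProbability : (D : Output n → Bool) (k : ℕ) (s : State) → ℚ
  haltingProbability D zero    s = 0ℚ
  haltingProbability D (suc k) s with step s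
  ... | output o   = if D o then 1ℚ else 0ℚ
  ... | query x f  = haltingProbability D k (f (B x))
  ... | sample f   = mean (map (haltingProbability D k ∘ f) (elements B))
  ... | random m f = mean (map (haltingProbability D k ∘ f) (allFin (suc m)))

  -- The probability that the output satisfies E.  For decidable E this is the
  -- limit over k of haltingProbability E k start.  Comparing a natural number
  -- with a real is not decidable constructively, so in general one takes the
  -- supremum over the decidable D contained in E.
  Pr : (E : Output n → Set) → ℝ̄
  Pr E = sup {∃ λ (D : Output n → Bool) → (∀ o → T (D o) → E o) × ℕ} λ (D , _ , k) →
           fromℚ (haltingProbability D k start)

-- The event that the output is a subspace V with |V| ≤ |H| and 𝒩_V(H) ≤ M.
Success : ∀ {n} → ℝ̄ → Subset n → Output n → Set
Success M H = Any λ V → ∣ carrier V ∣ ℕ.≤ ∣ H ∣ × fromℕ (coveringNumber V H) ≤ℝ M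

{-# OPTIONS --safe #-}

-- The algorithm sees only B, so both success probabilities refer to one and the
-- same output distribution, and it suffices that the two events are disjoint.
-- If V succeeds for both instances, write H₀ ⊆ T₀ + V and H₁ ⊆ T₁ + V with
-- |T₀|, |T₁| ≤ M.  Then U + X + Y ⊆ T₀ + T₁ + V, and counting gives
-- |U| |X| |Y| ≤ |T₀| |T₁| |V| ≤ |T₀| |T₁| |H₀| ≤ |T₀| |T₁| |U| |X|, so
-- 2ᵗ = |Y| ≤ M², which contradicts t > 2 log₂ M.
module Submission where

open import Defs
open import Algebra.Bundles using (CommutativeMonoid)
import Algebra.Properties.CommutativeSemigroup as CommutativeSemigroup
open import Data.Bool.Base using (Bool; true; false; T; _∨_; _xor_; not)
import Data.Bool.Properties as Bool
open import Data.Empty using (⊥-elim)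
import Data.Fin.Base as Fin
open import Data.Fin.Properties using (injective⇒≤)
open import Data.Integer.Base as ℤ using (+_)
import Data.Integer.Properties as ℤ
open import Data.List.Base
  using (List; []; _∷_; allFin; cartesianProduct; filterᵇ; foldr; length; lookup; map)
open import Data.List.Extrema.Nat using (argmin-sel)
open import Data.List.Membership.Propositional using (lose; find) renaming (_∈_ to _∈ˡ_)
open import Data.List.Membership.Propositional.Properties
  using (∈-++⁺ˡ; ∈-++⁺ʳ; ∈-map⁺; ∈-map⁻; ∈-filter⁺; ∈-filter⁻; ∈-lookup;
         ∈-cartesianProduct⁺; ∈-cartesianProduct⁻)
open import Data.List.Properties using (length-map; length-++)
open import Data.List.Relation.Unary.All as All using (All; []; _∷_)
import Data.List.Relation.Unary.All.Properties as All
open import Data.List.Relation.Unary.AllPairs using ([]; _∷_)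
open import Data.List.Relation.Unary.Any using (here; index)
open import Data.List.Relation.Unary.Any.Properties using (any⁺; any⁻; lookup-index)
open import Data.List.Relation.Unary.Unique.Propositional using (Unique)
import Data.List.Relation.Unary.Unique.Propositional.Properties as Unique
open import Data.Maybe.Relation.Unary.Any using (just)
open import Data.Nat.Base as ℕ using (ℕ; zero; suc)
import Data.Nat.Properties as ℕ
open import Data.Product.Base using (∃; ∃₂; _×_; _,_; proj₁; proj₂)
open import Data.Rational.Base as ℚ using (ℚ; ½; 0ℚ; 1ℚ; fromℚᵘ; toℚᵘ)
import Data.Rational.Properties as ℚ
open import Data.Rational.Unnormalised.Base as ℚᵘ using (mkℚᵘ; *≡*; *<*)
import Data.Rational.Unnormalised.Properties as ℚᵘ
open import Data.Sum.Base using (inj₁; inj₂)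
open import Data.Vec.Base as Vec using (Vec; []; _∷_)
import Data.Vec.Properties as Vec
open import Function.Base using (_∘_; const; id)
open import Function.Bundles using (Equivalence)
open import Relation.Binary.PropositionalEquality
open import Relation.Nullary.Decidable using (fromWitness; toWitness)
open import Relation.Nullary.Negation using (¬_; contradiction)

-- Counting with repetition-free lists

lookup-injective : ∀ {A : Set} {xs : List A} → Unique xs →
                   ∀ {i j} → lookup xs i ≡ lookup xs j → i ≡ j
lookup-injective (_ ∷ _)       {Fin.zero}  {Fin.zero}  _  = refl
lookup-injective (x∉xs ∷ _)    {Fin.zero}  {Fin.suc j} eq = contradiction eq (All.lookup x∉xs (∈-lookup j))
lookup-injective (x∉xs ∷ _)    {Fin.suc i} {Fin.zero}  eq = contradiction (sym eq) (All.lookup x∉xs (∈-lookup i))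
lookup-injective (_ ∷ unique)  {Fin.suc i} {Fin.suc j} eq = cong Fin.suc (lookup-injective unique eq)

length-cartesianProduct : ∀ {A B : Set} (xs : List A) (ys : List B) →
                          length (cartesianProduct xs ys) ≡ length xs ℕ.* length ys
length-cartesianProduct []       ys = refl
length-cartesianProduct (x ∷ xs) ys = trans (length-++ (map (x ,_) ys))
  (cong₂ ℕ._+_ (length-map (x ,_) ys) (length-cartesianProduct xs ys))

-- A left-unique relation that is total on xs is an injection with the choice of
-- the image left open.
length-≤ : ∀ {A B : Set} (R : A → B → Set) {xs : List A} {ys : List B} →
           Unique xs →
           (∀ {x x′ y} → x ∈ˡ xs → x′ ∈ˡ xs → R x y → R x′ y → x ≡ x′) →
           (∀ {x} → x ∈ˡ xs → ∃ λ y → y ∈ˡ ys × R x y) →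
           length xs ℕ.≤ length ys
length-≤ R {xs} {ys} unique left-unique total = injective⇒≤ f-injective
  where
  image = λ i → total (∈-lookup {xs = xs} i)
  -- The chosen image is recorded as a position in `ys`, so that the pigeonhole principle for `Fin`
  -- gives the bound without any uniqueness in `ys`.
  f     = λ i → index (proj₁ (proj₂ (image i)))

  R-f : ∀ i → R (lookup xs i) (lookup ys (f i))
  R-f i = subst (R _) (lookup-index (proj₁ (proj₂ (image i)))) (proj₂ (proj₂ (image i)))

  f-injective : ∀ {i j} → f i ≡ f j → i ≡ j
  f-injective {i} {j} fi≡fj = lookup-injective unique
    (left-unique (∈-lookup i) (∈-lookup j)
      (R-f i) (subst (R _ ∘ lookup ys) (sym fi≡fj) (R-f j)))

-- Vectors and subsets of 𝔽₂ⁿ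

+ᵛ-assoc : ∀ {n} (x y z : 𝔽₂^ n) → (x +ᵛ y) +ᵛ z ≡ x +ᵛ (y +ᵛ z)
+ᵛ-assoc = Vec.zipWith-assoc Bool.xor-assoc

+ᵛ-comm : ∀ {n} (x y : 𝔽₂^ n) → x +ᵛ y ≡ y +ᵛ x
+ᵛ-comm = Vec.zipWith-comm Bool.xor-comm

+ᵛ-identityˡ : ∀ {n} (x : 𝔽₂^ n) → 0ᵛ +ᵛ x ≡ x
+ᵛ-identityˡ = Vec.zipWith-identityˡ Bool.xor-identityˡ

+ᵛ-identityʳ : ∀ {n} (x : 𝔽₂^ n) → x +ᵛ 0ᵛ ≡ x
+ᵛ-identityʳ = Vec.zipWith-identityʳ Bool.xor-identityʳ

+ᵛ-same : ∀ {n} (x : 𝔽₂^ n) → x +ᵛ x ≡ 0ᵛ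
+ᵛ-same []      = refl
+ᵛ-same (b ∷ x) = cong₂ _∷_ (Bool.xor-same b) (+ᵛ-same x)

+ᵛ-interchange : ∀ {n} (a v b w : 𝔽₂^ n) → (a +ᵛ v) +ᵛ (b +ᵛ w) ≡ (a +ᵛ b) +ᵛ (v +ᵛ w)
+ᵛ-interchange {n} = CommutativeSemigroup.interchange (record
  { Carrier = 𝔽₂^ n
  ; _≈_     = _≡_
  ; _∙_     = _+ᵛ_
  ; isCommutativeSemigroup = record
    { isSemigroup = record
      { isMagma = isMagma _+ᵛ_
      ; assoc   = +ᵛ-assoc
      }
    ; comm = +ᵛ-comm
    }
  })

x+y≡0⇒x≡y : ∀ {n} (x y : 𝔽₂^ n) → x +ᵛ y ≡ 0ᵛ → x ≡ y
x+y≡0⇒x≡y x y x+y≡0 = begin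
  x                ≡⟨ +ᵛ-identityʳ x ⟨
  x +ᵛ 0ᵛ          ≡⟨ cong (x +ᵛ_) (+ᵛ-same y) ⟨
  x +ᵛ (y +ᵛ y)    ≡⟨ +ᵛ-assoc x y y ⟨
  (x +ᵛ y) +ᵛ y    ≡⟨ cong (_+ᵛ y) x+y≡0 ⟩
  0ᵛ +ᵛ y          ≡⟨ +ᵛ-identityˡ y ⟩
  y                ∎
  where open ≡-Reasoning

·ᵛ-distribʳ : ∀ {n} b c (v : 𝔽₂^ n) → (b xor c) ·ᵛ v ≡ b ·ᵛ v +ᵛ c ·ᵛ v
·ᵛ-distribʳ b c []      = refl
·ᵛ-distribʳ b c (a ∷ v) = cong₂ _∷_ (Bool.∧-distribʳ-xor a b c) (·ᵛ-distribʳ b c v)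

linearCombination-+ : ∀ {n t} (bs cs : Vec Bool t) (vs : Vec (𝔽₂^ n) t) →
  linearCombination (bs +ᵛ cs) vs ≡ linearCombination bs vs +ᵛ linearCombination cs vs
linearCombination-+ []       []       []       = sym (+ᵛ-identityˡ 0ᵛ)
linearCombination-+ (b ∷ bs) (c ∷ cs) (v ∷ vs) =
  trans (cong₂ _+ᵛ_ (·ᵛ-distribʳ b c v) (linearCombination-+ bs cs vs))
        (+ᵛ-interchange (b ·ᵛ v) (c ·ᵛ v) _ _)

linearCombination-∈ : ∀ {n t} (V : Subspace n) (cs : Vec Bool t) (vs : Vec (𝔽₂^ n) t) →
  (∀ i → Vec.lookup vs i ∈ carrier V) → linearCombination cs vs ∈ carrier V
linearCombination-∈ V []       []       vs∈V = Subspace.0∈ V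
linearCombination-∈ V (c ∷ cs) (v ∷ vs) vs∈V = Subspace.+-closed V
  (Subspace.·-closed V c (vs∈V Fin.zero))
  (linearCombination-∈ V cs vs (vs∈V ∘ Fin.suc))

∈-points : ∀ {n} (x : 𝔽₂^ n) → x ∈ˡ points n
∈-points []          = here refl
∈-points (false ∷ x) = ∈-++⁺ˡ (∈-map⁺ _ (∈-points x))
∈-points (true ∷ x)  = ∈-++⁺ʳ _ (∈-map⁺ _ (∈-points x))

points-unique : ∀ n → Unique (points n)
points-unique zero    = [] ∷ []
points-unique (suc n) = Unique.++⁺
  (Unique.map⁺ Vec.∷-injectiveʳ (points-unique n))
  (Unique.map⁺ Vec.∷-injectiveʳ (points-unique n))
  λ (p , q) → disjoint (∈-map⁻ _ p) (∈-map⁻ _ q)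
  where
  disjoint : ∀ {x : 𝔽₂^ (suc n)} → (∃ λ y → y ∈ˡ points n × x ≡ false ∷ y) →
             ¬ (∃ λ y → y ∈ˡ points n × x ≡ true ∷ y)
  disjoint (_ , _ , refl) (_ , _ , ())

length-points : ∀ n → length (points n) ≡ 2 ℕ.^ n
length-points zero    = refl
length-points (suc n) = begin
  length (points (suc n))                        ≡⟨ length-++ (map (false ∷_) (points n)) ⟩
  length (map (false ∷_) (points n)) ℕ.+ length (map (true ∷_) (points n))
    ≡⟨ cong₂ ℕ._+_ (half false) (trans (half true) (sym (ℕ.+-identityʳ _))) ⟩
  2 ℕ.^ suc n                                    ∎
  where
  open ≡-Reasoning
  half : ∀ b → length (map (b ∷_) (points n)) ≡ 2 ℕ.^ n
  half b = trans (length-map (b ∷_) (points n)) (length-points n)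

∈-elements⁺ : ∀ {n} (S : Subset n) {x} → x ∈ S → x ∈ˡ elements S
∈-elements⁺ S = ∈-filter⁺ (Bool.T? ∘ S) (∈-points _)

∈-elements⁻ : ∀ {n} (S : Subset n) {x} → x ∈ˡ elements S → x ∈ S
∈-elements⁻ S x∈ = proj₂ (∈-filter⁻ (Bool.T? ∘ S) {xs = points _} x∈)

elements-unique : ∀ {n} (S : Subset n) → Unique (elements S)
elements-unique S = Unique.filter⁺ (Bool.T? ∘ S) (points-unique _)

⊆ᵇ⇒⊆ : ∀ {n} (A B : Subset n) → T (A ⊆ᵇ B) → ∀ {x} → x ∈ A → x ∈ B
⊆ᵇ⇒⊆ A B A⊆B {x} = implication (A x) (All.lookup (All.all⁺ _ (points _) A⊆B) (∈-points x))
  where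
  implication : ∀ a {b} → T (not a ∨ b) → T a → T b
  implication true p _ = p

∈-+ˢ⁺ : ∀ {n} (A B : Subset n) {a b} → a ∈ A → b ∈ B → a +ᵛ b ∈ A +ˢ B
∈-+ˢ⁺ A B {a} {b} a∈A b∈B =
  any⁺ _ (lose (∈-points a) (any⁺ _ (lose (∈-points b)
    (Equivalence.from Bool.T-∧ (a∈A , Equivalence.from Bool.T-∧ (b∈B , fromWitness refl))))))

∈-+ˢ⁻ : ∀ {n} (A B : Subset n) {x} → x ∈ A +ˢ B →
        ∃₂ λ a b → a ∈ A × b ∈ B × a +ᵛ b ≡ x
∈-+ˢ⁻ A B x∈A+B =
  let a , _ , p     = find (any⁻ _ (points _) x∈A+B)
      b , _ , q     = find (any⁻ _ (points _) p)
      a∈A , r       = Equivalence.to Bool.T-∧ q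
      b∈B , a+b≟x   = Equivalence.to Bool.T-∧ r
  in a , b , a∈A , b∈B , toWitness a+b≟x

-- Each element of the sumset is related to the pairs that sum to it. A pair determines its sum, so
-- the relation is left-unique.
∣+ˢ∣≤∣∣*∣∣ : ∀ {n} (A B : Subset n) → ∣ A +ˢ B ∣ ℕ.≤ ∣ A ∣ ℕ.* ∣ B ∣
∣+ˢ∣≤∣∣*∣∣ A B = subst (∣ A +ˢ B ∣ ℕ.≤_) (length-cartesianProduct (elements A) (elements B))
  (length-≤ (λ x (a , b) → a +ᵛ b ≡ x) (elements-unique (A +ˢ B))
    (λ _ _ p q → trans (sym p) q)
    λ x∈ → let a , b , a∈A , b∈B , eq = ∈-+ˢ⁻ A B (∈-elements⁻ (A +ˢ B) x∈)
           in (a , b) , ∈-cartesianProduct⁺ (∈-elements⁺ A a∈A) (∈-elements⁺ B b∈B) , eq)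

-- Coefficient vectors inject into `V`. Independence only says that the kernel of
-- `linearCombination` is trivial: if `bs` and `cs` give the same vector, additivity puts `bs +ᵛ cs`
-- into the kernel, and in characteristic two `bs +ᵛ cs ≡ 0ᵛ` means `bs ≡ cs`.
dimension⇒2^≤∣∣ : ∀ {n t} (V : Subspace n) → V HasDimension t → 2 ℕ.^ t ℕ.≤ ∣ carrier V ∣
dimension⇒2^≤∣∣ {t = t} V basis = subst (ℕ._≤ ∣ carrier V ∣) (length-points t)
  (length-≤ (λ cs x → linearCombination cs vectors ≡ x) (points-unique t)
    (λ {bs} {cs} _ _ p q → x+y≡0⇒x≡y bs cs (independent (bs +ᵛ cs) (begin
      linearCombination (bs +ᵛ cs) vectors  ≡⟨ linearCombination-+ bs cs vectors ⟩
      linearCombination bs vectors +ᵛ linearCombination cs vectors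
                                            ≡⟨ cong₂ _+ᵛ_ p q ⟩
      _ +ᵛ _                                ≡⟨ +ᵛ-same _ ⟩
      0ᵛ                                    ∎)))
    λ {cs} _ → _ , ∈-elements⁺ (carrier V) (linearCombination-∈ V cs vectors inside) , refl)
  where
  open Basis basis
  open ≡-Reasoning

-- Covering numbers and the counting inequality

∣∣-nonZero : ∀ {n} (V : Subspace n) → ℕ.NonZero ∣ carrier V ∣
∣∣-nonZero V with elements (carrier V) | ∈-elements⁺ (carrier V) (Subspace.0∈ V)
... | _ ∷ _ | _ = _

-- Replaces the number by an actual covering set of that size, from whose elements the counting
-- argument builds its triples.
coveringNumber-attained : ∀ {n} (V : Subspace n) (S : Subset n) →
  ∃ λ A → coveringNumber V S ≡ ∣ A ∣ × (∀ {x} → x ∈ S → x ∈ A +ˢ carrier V)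
coveringNumber-attained {n} V S
  with argmin-sel id ∣ const {B = 𝔽₂^ n} true ∣
         (map ∣_∣ (filterᵇ (λ A → S ⊆ᵇ A +ˢ carrier V) (subsets n)))
-- The minimum may be the default value, the size of the whole space. The whole space covers `S`
-- because `x` equals `x +ᵛ 0ᵛ`.
... | inj₁ min≡ = const true , min≡ , λ {x} _ →
  subst (_∈ const true +ˢ carrier V) (+ᵛ-identityʳ x)
    (∈-+ˢ⁺ (const true) (carrier V) {a = x} _ (Subspace.0∈ V))
... | inj₂ min∈ =
  let A , A∈ , min≡ = ∈-map⁻ ∣_∣ min∈
      covers        = proj₂ (∈-filter⁻ (Bool.T? ∘ λ A → S ⊆ᵇ A +ˢ carrier V) {xs = subsets n} A∈)
  in A , min≡ , ⊆ᵇ⇒⊆ S (A +ˢ carrier V) covers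

-- Triples `(u , x , y)` are related to triples `(a , b , v)` with the same sum. Directness says
-- that the sum determines `(u , x , y)`, which gives left-uniqueness; adding a covering
-- decomposition from each instance gives totality.
directSum-≤-coverings : ∀ {n} (U X Y V : Subspace n) → IsDirectSum U X Y →
  ∣ carrier U ∣ ℕ.* (∣ carrier X ∣ ℕ.* ∣ carrier Y ∣) ℕ.≤
  coveringNumber V (carrier U +ˢ carrier X) ℕ.*
    (coveringNumber V (carrier U +ˢ carrier Y) ℕ.* ∣ carrier V ∣)
directSum-≤-coverings {n} U X Y V direct
  with A , N₀≡ , cover₀ ← coveringNumber-attained V (carrier U +ˢ carrier X)
     | B , N₁≡ , cover₁ ← coveringNumber-attained V (carrier U +ˢ carrier Y)
  rewrite N₀≡ | N₁≡ =
  subst₂ ℕ._≤_ (length-triples (carrier U) (carrier X) (carrier Y))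
               (length-triples A B (carrier V))
    (length-≤ (λ p q → Σ₃ p ≡ Σ₃ q)
      (Unique.cartesianProduct⁺ (elements-unique (carrier U))
        (Unique.cartesianProduct⁺ (elements-unique (carrier X)) (elements-unique (carrier Y))))
      (λ {_} {_} {q} → left-unique {q = q}) total)
  where
  triples : (P Q R : Subset n) → List (𝔽₂^ n × 𝔽₂^ n × 𝔽₂^ n)
  triples P Q R = cartesianProduct (elements P) (cartesianProduct (elements Q) (elements R))

  Σ₃ : 𝔽₂^ n × 𝔽₂^ n × 𝔽₂^ n → 𝔽₂^ n
  Σ₃ (p , q , r) = p +ᵛ q +ᵛ r

  length-triples : ∀ P Q R → length (triples P Q R) ≡ ∣ P ∣ ℕ.* (∣ Q ∣ ℕ.* ∣ R ∣)
  length-triples P Q R =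
    trans (length-cartesianProduct (elements P) _)
          (cong (∣ P ∣ ℕ.*_) (length-cartesianProduct (elements Q) (elements R)))

  ∈-triples⁻ : ∀ P Q R {p q r} → (p , q , r) ∈ˡ triples P Q R → p ∈ P × q ∈ Q × r ∈ R
  ∈-triples⁻ P Q R pqr∈ =
    let p∈ , qr∈ = ∈-cartesianProduct⁻ (elements P) _ pqr∈
        q∈ , r∈  = ∈-cartesianProduct⁻ (elements Q) (elements R) qr∈
    in ∈-elements⁻ P p∈ , ∈-elements⁻ Q q∈ , ∈-elements⁻ R r∈

  left-unique : ∀ {p p′ q} →
                p ∈ˡ triples (carrier U) (carrier X) (carrier Y) →
                p′ ∈ˡ triples (carrier U) (carrier X) (carrier Y) →
                Σ₃ p ≡ Σ₃ q → Σ₃ p′ ≡ Σ₃ q → p ≡ p′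
  left-unique {q = q} p∈ p′∈ eq eq′
    with u∈ , x∈ , y∈ ← ∈-triples⁻ (carrier U) (carrier X) (carrier Y) p∈
       | u′∈ , x′∈ , y′∈ ← ∈-triples⁻ (carrier U) (carrier X) (carrier Y) p′∈
    with refl , refl , refl ← direct u∈ u′∈ x∈ x′∈ y∈ y′∈ (trans eq (sym eq′)) = refl

  total : ∀ {p} → p ∈ˡ triples (carrier U) (carrier X) (carrier Y) →
          ∃ λ q → q ∈ˡ triples A B (carrier V) ×
            Σ₃ p ≡ Σ₃ q
  total {u , x , y} p∈
    with u∈ , x∈ , y∈ ← ∈-triples⁻ (carrier U) (carrier X) (carrier Y) p∈
    with a , v , a∈ , v∈ , a+v≡ ← ∈-+ˢ⁻ A (carrier V) (cover₀ (∈-+ˢ⁺ (carrier U) (carrier X) u∈ x∈))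
       -- The component `u` is already accounted for in the first covering, so `y` enters the second
       -- instance as `0ᵛ +ᵛ y`.
       | b , w , b∈ , w∈ , b+w≡ ← ∈-+ˢ⁻ B (carrier V) (cover₁ (∈-+ˢ⁺ (carrier U) (carrier Y) (Subspace.0∈ U) y∈))
    -- Closure of `V` merges the two remainders into one, so that `∣ carrier V ∣` enters the bound
    -- only once.
    = (a , b , v +ᵛ w)
    , ∈-cartesianProduct⁺ (∈-elements⁺ A a∈) (∈-cartesianProduct⁺ (∈-elements⁺ B b∈)
        (∈-elements⁺ (carrier V) (Subspace.+-closed V v∈ w∈)))
    , (begin
      u +ᵛ x +ᵛ y             ≡⟨ cong (u +ᵛ x +ᵛ_) (+ᵛ-identityˡ y) ⟨
      u +ᵛ x +ᵛ (0ᵛ +ᵛ y)     ≡⟨ cong₂ _+ᵛ_ a+v≡ b+w≡ ⟨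
      (a +ᵛ v) +ᵛ (b +ᵛ w)    ≡⟨ +ᵛ-interchange a v b w ⟩
      a +ᵛ b +ᵛ (v +ᵛ w)      ∎)
    where open ≡-Reasoning

2^≤coverings : ∀ {n t} (U X Y V : Subspace n) → IsDirectSum U X Y → Y HasDimension t →
  ∣ carrier V ∣ ℕ.≤ ∣ carrier U +ˢ carrier X ∣ →
  2 ℕ.^ t ℕ.≤ coveringNumber V (carrier U +ˢ carrier X) ℕ.* coveringNumber V (carrier U +ˢ carrier Y)
2^≤coverings {t = t} U X Y V direct basis ∣V∣≤∣H₀∣ = ℕ.≤-trans (dimension⇒2^≤∣∣ Y basis)
  (ℕ.*-cancelˡ-≤ (u ℕ.* x) (begin
    (u ℕ.* x) ℕ.* y              ≡⟨ ℕ.*-assoc u x y ⟩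
    u ℕ.* (x ℕ.* y)              ≤⟨ directSum-≤-coverings U X Y V direct ⟩
    N₀ ℕ.* (N₁ ℕ.* v)            ≡⟨ ℕ.*-assoc N₀ N₁ v ⟨
    -- The size constraint on `V` brings the factor `u ℕ.* x` to the right-hand side. It is nonzero,
    -- since each subspace contains `0ᵛ`, and can then be cancelled, leaving `y` on the left.
    (N₀ ℕ.* N₁) ℕ.* v            ≤⟨ ℕ.*-monoʳ-≤ (N₀ ℕ.* N₁) (ℕ.≤-trans ∣V∣≤∣H₀∣ (∣+ˢ∣≤∣∣*∣∣ (carrier U) (carrier X))) ⟩
    (N₀ ℕ.* N₁) ℕ.* (u ℕ.* x)    ≡⟨ ℕ.*-comm (N₀ ℕ.* N₁) (u ℕ.* x) ⟩
    (u ℕ.* x) ℕ.* (N₀ ℕ.* N₁)    ∎))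
  where
  open ℕ.≤-Reasoning
  u  = ∣ carrier U ∣
  x  = ∣ carrier X ∣
  y  = ∣ carrier Y ∣
  v  = ∣ carrier V ∣
  N₀ = coveringNumber V (carrier U +ˢ carrier X)
  N₁ = coveringNumber V (carrier U +ˢ carrier Y)
  instance
    ux-nonZero : ℕ.NonZero (u ℕ.* x)
    ux-nonZero = ℕ.m*n≢0 u x {{∣∣-nonZero U}} {{∣∣-nonZero X}}

-- Natural numbers and means in ℚ

-- Normalisation hides the numerators and denominators of a sum in `ℚ`. Passing to unnormalised
-- fractions, here and for products, reduces the identities below to cross-multiplication in the
-- integers.
fromℚᵘ-homo-+ : ∀ p q → fromℚᵘ (p ℚᵘ.+ q) ≡ fromℚᵘ p ℚ.+ fromℚᵘ q
fromℚᵘ-homo-+ p q = ℚ.toℚᵘ-injective (begin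
  toℚᵘ (fromℚᵘ (p ℚᵘ.+ q))                 ≈⟨ ℚ.toℚᵘ-fromℚᵘ (p ℚᵘ.+ q) ⟩
  p ℚᵘ.+ q                                 ≈⟨ ℚᵘ.+-cong (ℚ.toℚᵘ-fromℚᵘ p) (ℚ.toℚᵘ-fromℚᵘ q) ⟨
  toℚᵘ (fromℚᵘ p) ℚᵘ.+ toℚᵘ (fromℚᵘ q)     ≈⟨ ℚ.toℚᵘ-homo-+ (fromℚᵘ p) (fromℚᵘ q) ⟨
  toℚᵘ (fromℚᵘ p ℚ.+ fromℚᵘ q)             ∎)
  where open ℚᵘ.≃-Reasoning

fromℚᵘ-homo-* : ∀ p q → fromℚᵘ (p ℚᵘ.* q) ≡ fromℚᵘ p ℚ.* fromℚᵘ q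
fromℚᵘ-homo-* p q = ℚ.toℚᵘ-injective (begin
  toℚᵘ (fromℚᵘ (p ℚᵘ.* q))                 ≈⟨ ℚ.toℚᵘ-fromℚᵘ (p ℚᵘ.* q) ⟩
  p ℚᵘ.* q                                 ≈⟨ ℚᵘ.*-cong (ℚ.toℚᵘ-fromℚᵘ p) (ℚ.toℚᵘ-fromℚᵘ q) ⟨
  toℚᵘ (fromℚᵘ p) ℚᵘ.* toℚᵘ (fromℚᵘ q)     ≈⟨ ℚ.toℚᵘ-homo-* (fromℚᵘ p) (fromℚᵘ q) ⟨
  toℚᵘ (fromℚᵘ p ℚ.* fromℚᵘ q)             ∎)
  where open ℚᵘ.≃-Reasoning

suc/1 : ∀ m → 1ℚ ℚ.+ + m ℚ./ 1 ≡ + suc m ℚ./ 1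
suc/1 m = trans (sym (fromℚᵘ-homo-+ (mkℚᵘ (+ 1) 0) (mkℚᵘ (+ m) 0)))
  (ℚ.fromℚᵘ-cong {mkℚᵘ (+ 1) 0 ℚᵘ.+ mkℚᵘ (+ m) 0} {mkℚᵘ (+ suc m) 0}
    (*≡* (cong (λ i → (+ 1 ℤ.+ i) ℤ.* + 1) (ℤ.*-identityʳ (+ m)))))

*/1 : ∀ m n → + (m ℕ.* n) ℚ./ 1 ≡ + m ℚ./ 1 ℚ.* (+ n ℚ./ 1)
*/1 m n = trans
  (ℚ.fromℚᵘ-cong {mkℚᵘ (+ (m ℕ.* n)) 0} {mkℚᵘ (+ m) 0 ℚᵘ.* mkℚᵘ (+ n) 0} (*≡* (cong (ℤ._* + 1) (ℤ.pos-* m n))))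
  (fromℚᵘ-homo-* (mkℚᵘ (+ m) 0) (mkℚᵘ (+ n) 0))

/1-cancel-< : ∀ {m n} → + m ℚ./ 1 ℚ.< + n ℚ./ 1 → m ℕ.< n
/1-cancel-< {m} {n} m<n with ℚᵘ.<-respˡ-≃ (ℚ.toℚᵘ-fromℚᵘ (mkℚᵘ (+ m) 0))
                            (ℚᵘ.<-respʳ-≃ (ℚ.toℚᵘ-fromℚᵘ (mkℚᵘ (+ n) 0)) (ℚ.toℚᵘ-mono-< m<n))
... | *<* m*1<n*1 = ℤ.drop‿+<+ (ℤ.*-cancelʳ-<-nonNeg (+ 1) m*1<n*1)

0≤/1 : ∀ m → 0ℚ ℚ.≤ + m ℚ./ 1
0≤/1 m = ℚ.nonNegative⁻¹ (+ m ℚ./ 1) {{ℚ.normalize-nonNeg m 1}}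

n/1*1/n≡1 : ∀ k → + suc k ℚ./ 1 ℚ.* (+ 1 ℚ./ suc k) ≡ 1ℚ
n/1*1/n≡1 k = trans (sym (fromℚᵘ-homo-* (mkℚᵘ (+ suc k) 0) (mkℚᵘ (+ 1) k)))
  (ℚ.fromℚᵘ-cong {mkℚᵘ (+ suc k) 0 ℚᵘ.* mkℚᵘ (+ 1) k} {mkℚᵘ (+ 1) 0} (*≡* (begin
    (+ suc k ℤ.* + 1) ℤ.* + 1     ≡⟨ ℤ.*-identityʳ _ ⟩
    + suc k ℤ.* + 1               ≡⟨ ℤ.*-comm (+ suc k) (+ 1) ⟩
    -- The product of the denominators `1` and `suc k` computes to `suc (k ℕ.+ 0)`.
    + 1 ℤ.* + suc k               ≡⟨ cong (λ i → + 1 ℤ.* + suc i) (sym (ℕ.+-identityʳ k)) ⟩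
    + 1 ℤ.* + suc (k ℕ.+ 0)       ∎)))
  where open ≡-Reasoning

sum : List ℚ → ℚ
sum = foldr ℚ._+_ 0ℚ

sum-≤ : ∀ {qs} → All (ℚ._≤ 1ℚ) qs → sum qs ℚ.≤ + length qs ℚ./ 1
sum-≤ []                       = ℚ.≤-refl
sum-≤ {_ ∷ qs} (q≤1 ∷ qs≤1) =
  ℚ.≤-trans (ℚ.+-mono-≤ q≤1 (sum-≤ qs≤1)) (ℚ.≤-reflexive (suc/1 (length qs)))

mean-≤1 : ∀ {qs} → All (ℚ._≤ 1ℚ) qs → mean qs ℚ.≤ 1ℚ
-- The empty mean is `0ℚ` by convention.
mean-≤1 []                 = 0≤/1 1
mean-≤1 {_ ∷ qs} qs≤1 = ℚ.≤-trans
  (ℚ.*-monoʳ-≤-nonNeg (+ 1 ℚ./ suc (length qs)) {{ℚ.normalize-nonNeg 1 (suc (length qs))}} (sum-≤ qs≤1))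
  (ℚ.≤-reflexive (n/1*1/n≡1 (length qs)))

module _ {A : Set} (f g : A → ℚ) where

  sum-+ : ∀ xs → sum (map f xs) ℚ.+ sum (map g xs) ≡
                 sum (map (λ x → f x ℚ.+ g x) xs)
  sum-+ []       = refl
  sum-+ (x ∷ xs) = trans
    (CommutativeSemigroup.interchange (CommutativeMonoid.commutativeSemigroup ℚ.+-0-commutativeMonoid)
      (f x) (sum (map f xs)) (g x) (sum (map g xs)))
    (cong (f x ℚ.+ g x ℚ.+_) (sum-+ xs))

  mean-+ : ∀ xs → mean (map f xs) ℚ.+ mean (map g xs) ≡ mean (map (λ x → f x ℚ.+ g x) xs)
  mean-+ []       = refl
  mean-+ (x ∷ xs)
    -- With the three lengths identified, all three means carry the same factor, and distributivity
    -- applies.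
    rewrite length-map f xs | length-map g xs | length-map (λ z → f z ℚ.+ g z) xs =
    trans (sym (ℚ.*-distribʳ-+ (+ 1 ℚ./ suc (length xs)) (sum (map f (x ∷ xs))) (sum (map g (x ∷ xs)))))
          (cong (ℚ._* (+ 1 ℚ./ suc (length xs))) (sum-+ (x ∷ xs)))

mean-map-≤1 : ∀ {A : Set} (f : A → ℚ) xs → (∀ x → f x ℚ.≤ 1ℚ) → mean (map f xs) ℚ.≤ 1ℚ
mean-map-≤1 f xs f≤1 = mean-≤1 (All.map⁺ (All.universal f≤1 xs))

-- The averaging step of the induction on runs: two events are averaged over the same random
-- outcomes, so a bound on their sum at each outcome survives.
mean-map-+-≤1 : ∀ {A : Set} (f g : A → ℚ) xs → (∀ x → f x ℚ.+ g x ℚ.≤ 1ℚ) →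
                mean (map f xs) ℚ.+ mean (map g xs) ℚ.≤ 1ℚ
mean-map-+-≤1 f g xs f+g≤1 =
  subst (ℚ._≤ 1ℚ) (sym (mean-+ f g xs)) (mean-map-≤1 (λ x → f x ℚ.+ g x) xs f+g≤1)

-- Halting probabilities of disjoint events

module _ {n} (𝒜 : Algorithm n) (B : Subset n) where
  open Algorithm 𝒜

  haltingProbability-≤1 : ∀ D k s → haltingProbability 𝒜 B D k s ℚ.≤ 1ℚ
  haltingProbability-≤1 D zero    s = 0≤/1 1
  haltingProbability-≤1 D (suc k) s with step s
  ... | output o with D o
  ...   | true  = ℚ.≤-refl
  ...   | false = 0≤/1 1
  haltingProbability-≤1 D (suc k) s | query x f  = haltingProbability-≤1 D k (f (B x))
  haltingProbability-≤1 D (suc k) s | sample f   =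
    mean-map-≤1 _ (elements B) (haltingProbability-≤1 D k ∘ f)
  haltingProbability-≤1 D (suc k) s | random m f =
    mean-map-≤1 _ (allFin (suc m)) (haltingProbability-≤1 D k ∘ f)

  module _ (D E : Output n → Bool) (disjoint : ∀ o → T (D o) → ¬ T (E o)) where

    -- Both probabilities follow the same machine from the same state, so their branches match step
    -- by step, and at an output at most one event holds. The step bounds `k` and `l` are
    -- independent because the two suprema choose theirs separately; once one bound is exhausted its
    -- term is `0ℚ` and the other is at most `1ℚ`.
    haltingProbability-disjoint : ∀ k l s →
      haltingProbability 𝒜 B D k s ℚ.+ haltingProbability 𝒜 B E l s ℚ.≤ 1ℚ
    haltingProbability-disjoint zero    l       s =
      subst (ℚ._≤ 1ℚ) (sym (ℚ.+-identityˡ _)) (haltingProbability-≤1 E l s)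
    haltingProbability-disjoint (suc k) zero    s =
      subst (ℚ._≤ 1ℚ) (sym (ℚ.+-identityʳ _)) (haltingProbability-≤1 D (suc k) s)
    haltingProbability-disjoint (suc k) (suc l) s with step s
    ... | output o with D o | E o | disjoint o
    ...   | true  | true  | ¬both = ⊥-elim (¬both _ _)
    ...   | true  | false | _     = ℚ.≤-refl
    ...   | false | true  | _     = ℚ.≤-refl
    ...   | false | false | _     = 0≤/1 1
    haltingProbability-disjoint (suc k) (suc l) s | query x f  =
      haltingProbability-disjoint k l (f (B x))
    haltingProbability-disjoint (suc k) (suc l) s | sample f   =
      mean-map-+-≤1 (haltingProbability 𝒜 B D k ∘ f) (haltingProbability 𝒜 B E l ∘ f)
        (elements B) (haltingProbability-disjoint k l ∘ f)
    haltingProbability-disjoint (suc k) (suc l) s | random m f =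
      mean-map-+-≤1 (haltingProbability 𝒜 B D k ∘ f) (haltingProbability 𝒜 B E l ∘ f)
        (allFin (suc m)) (haltingProbability-disjoint k l ∘ f)

-- Real comparisons and the final bound

fromℚ-cancel-≤ : ∀ {p q} → fromℚ p ≤ℝ fromℚ q → p ℚ.≤ q
-- If `q` were less than `p`, the inclusion of cuts would put `q` into its own strict lower cut.
fromℚ-cancel-≤ p≤q = ℚ.≮⇒≥ (ℚ.<-irrefl refl ∘ p≤q)

-- Otherwise `1ℚ` would be at most `p ℚ.+ p`, which is strictly below `q ℚ.+ r`. This is the bound
-- by one half in terms of cuts: `p` is a rational below both probabilities.
+≤1⇒<½ : ∀ {p} q r → p ℚ.< q → p ℚ.< r → q ℚ.+ r ℚ.≤ 1ℚ → p ℚ.< ½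
+≤1⇒<½ q r p<q p<r q+r≤1 = ℚ.≰⇒> λ ½≤p →
  ℚ.<-irrefl refl (ℚ.≤-<-trans (ℚ.+-mono-≤ ½≤p ½≤p) (ℚ.<-≤-trans (ℚ.+-mono-< p<q p<r) q+r≤1))

-- The rational `r` lies between `M` and the square root of `2 ℕ.^ t`, so both covering numbers are
-- at most `r` and no product of reals is formed.
coverings-<2^ : ∀ {M t} N₀ N₁ → 2log₂ M < t → fromℕ N₀ ≤ℝ M → fromℕ N₁ ≤ℝ M → N₀ ℕ.* N₁ ℕ.< 2 ℕ.^ t
coverings-<2^ {t = t} N₀ N₁ (r , M≤r , r²<2ᵗ) N₀≤M N₁≤M = /1-cancel-< (begin-strict
  + (N₀ ℕ.* N₁) ℚ./ 1              ≡⟨ */1 N₀ N₁ ⟩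
  + N₀ ℚ./ 1 ℚ.* (+ N₁ ℚ./ 1)      ≤⟨ ℚ.*-monoʳ-≤-nonNeg (+ N₁ ℚ./ 1) {{ℚ.normalize-nonNeg N₁ 1}} N₀≤r ⟩
  -- The hypothesis on `t` does not fix the sign of `r`; it is nonnegative because it bounds the
  -- natural number `N₀`.
  r ℚ.* (+ N₁ ℚ./ 1)               ≤⟨ ℚ.*-monoˡ-≤-nonNeg r {{ℚ.nonNegative (ℚ.≤-trans (0≤/1 N₀) N₀≤r)}} N₁≤r ⟩
  r ℚ.* r                          <⟨ r²<2ᵗ ⟩
  + (2 ℕ.^ t) ℚ./ 1                ∎)
  where
  open ℚ.≤-Reasoning
  N₀≤r : + N₀ ℚ./ 1 ℚ.≤ r
  N₀≤r = fromℚ-cancel-≤ (M≤r ∘ N₀≤M)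
  N₁≤r : + N₁ ℚ./ 1 ℚ.≤ r
  N₁≤r = fromℚ-cancel-≤ (M≤r ∘ N₁≤M)

-- A failing output lies in neither event. For a common `V`, counting bounds the product of the two
-- covering numbers below by `2 ℕ.^ t`, while the choice of `t` makes it strictly smaller.
success-disjoint : ∀ M {n t} (U X Y : Subspace n) → 2log₂ M < t →
  IsDirectSum U X Y → Y HasDimension t → ∀ o →
  Success M (carrier U +ˢ carrier X) o → ¬ Success M (carrier U +ˢ carrier Y) o
success-disjoint M {t = t} U X Y M<t direct basis _
  (just {x = V} (∣V∣≤∣H₀∣ , N₀≤M)) (just (_ , N₁≤M)) =
  ℕ.<⇒≱ (coverings-<2^ {M} {t} (coveringNumber V (carrier U +ˢ carrier X))
    (coveringNumber V (carrier U +ˢ carrier Y)) M<t N₀≤M N₁≤M) (2^≤coverings U X Y V direct basis ∣V∣≤∣H₀∣)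

corollary9p3 :
    (M : ℝ̄) → fromℕ 1 ≤ℝ M →
    (t : ℕ) → 2log₂ M < t →
    (n : ℕ) (U X Y : Subspace n) →
    IsDirectSum U X Y →
    X HasDimension t →
    Y HasDimension t →
    let H₀ = carrier U +ˢ carrier X
        H₁ = carrier U +ˢ carrier Y
        B  = carrier U
    in
    (𝒜 : Algorithm n) →
    Pr 𝒜 B (Success M H₀) ⊓ℝ Pr 𝒜 B (Success M H₁) ≤ℝ fromℚ ½
corollary9p3 M _ t M<t n U X Y direct _ basis 𝒜 (((D , D⊆S₀ , k) , q<p₀) , ((E , E⊆S₁ , l) , q<p₁)) =
  -- A rational `q` below the minimum of the two suprema supplies for each event a decidable
  -- subevent and a step bound. The subevents `D` and `E` inherit disjointness from the success
  -- events.
  +≤1⇒<½ (haltingProbability 𝒜 (carrier U) D k start) (haltingProbability 𝒜 (carrier U) E l start) q<p₀ q<p₁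
    (haltingProbability-disjoint 𝒜 (carrier U) D E
      (λ o d e → success-disjoint M U X Y M<t direct basis o (D⊆S₀ o d) (E⊆S₁ o e))
      k l start)
  where open Algorithm 𝒜
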